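{- For every integer $n\ge1$, the complete graph $K_{2n}$ is map-rich.
   Context: A map is a triple $M=(C_M,v_M,f_M)$ where $C_M$ is a finite cubic graph (multiple edges allowed) and $v_M,f_M$ are disjoint perfect matchings whose union is a disjoint union of 4-cycles, the squares ($SQ(M)$). $a_M=E(C_M)\setminus(v_M\cup f_M)$; $z_M$ is the matching of square diagonals; $Q_M=C_M\cup z_M$. For a map $X$, $G_X$ has vertices the cycles of $v_X\cup a_X$ and edges the squares, each square joining the cycles containing its two $v_X$-edges. The dual is $D=(C_M,f_M,v_M)$, the phial $P=(Q_M\setminus v_M,z_M,f_M)$; edge sets of $G_M,G_D,G_P$ are identified with $SQ(M)$, and $V,F,Z$ denote their $GF(2)$-coboundary spaces, $V^\perp$ the cycle space of $G_M$. $M$ is rich if $V^\perp=F+Z$. A graph $G$ is map-rich if $G\cong G_M$ for some rich map $M$. -}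

module Defs where

open import Algebra.Bundles using (CommutativeRing)
import Algebra.Properties.CommutativeMonoid.Sum as Sum
open import Data.Bool using (Bool; true; false; not; _∧_; _∨_; _xor_)
open import Data.Bool.Properties using (xor-∧-commutativeRing)
open import Data.Fin as Fin using (Fin)
open import Data.List using ([]; _∷_)
open import Data.List.Relation.Unary.Unique.Propositional using (Unique)
open import Data.Nat using (ℕ)
open import Data.Product
  using (Σ-syntax; ∃; ∃!; ∃-syntax; _×_; _,_; proj₁; proj₂)
open import Data.Refinement using (Refinement-syntax; value)
open import Data.Sum using (_⊎_; [_,_]′)
open import Function using (_∘_; const; Inverse; _↔_; _⇔_)
open import Function.Construct.Identity using (↔-id)
open import Level using (0ℓ)
open import Relation.Binary.Bundles using (Setoid)
open import Relation.Binary.Core using (Rel)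
open import Relation.Binary.Construct.Closure.Equivalence as EqC
  using (EqClosure)
open import Relation.Binary.PropositionalEquality as ≡ using (_≡_; _≢_)
open import Relation.Nullary using (¬_)
open import Relation.Unary using (Pred; _≐_)

-- Undirected multigraphs on a finite vertex set.  The Boolean only tells the
-- two ends of an edge apart; it carries no orientation.
record Graph : Set₁ where
  field
    V E    : Set
    #V     : ℕ
    V-enum : V ↔ Fin #V
    end    : E → Bool → V

  index : V → Fin #V
  index = Inverse.to V-enum

  HalfEdge : Set
  HalfEdge = E × Bool

  at : HalfEdge → V
  at (e , b) = end e b

  EdgeSet : Set
  EdgeSet = E → Bool

  _∪_ : EdgeSet → EdgeSet → EdgeSet
  (S ∪ T) e = S e ∨ T e

  ∁ : EdgeSet → EdgeSet
  ∁ S e = not (S e)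

  Adj : EdgeSet → Rel V 0ℓ
  Adj S x y =
    ∃[ e ] S e ≡ true × ∃[ b ] (end e b ≡ x × end e (not b) ≡ y)

  -- In the same component of the spanning subgraph with edge set S.
  Connected : EdgeSet → Rel V 0ℓ
  Connected S = EqClosure (Adj S)

  Cubic : Set
  Cubic = ∀ x → (∃[ h ] at h ≡ x) ↔ Fin 3

  PerfectMatching : EdgeSet → Set
  PerfectMatching S = ∀ x → ∃! _≡_ λ h → S (proj₁ h) ≡ true × at h ≡ x

  OnFourCycle : EdgeSet → V → Set
  OnFourCycle S x₀ = ∃[ x₁ ] ∃[ x₂ ] ∃[ x₃ ]
    Unique (x₀ ∷ x₁ ∷ x₂ ∷ x₃ ∷ []) ×
    Adj S x₀ x₁ × Adj S x₁ x₂ × Adj S x₂ x₃ × Adj S x₃ x₀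

_∖_ : (G : Graph) → Graph.EdgeSet G → Graph
G ∖ S = record
  { V = V ; #V = #V ; V-enum = V-enum
  ; E = [ e ∈ E ∣ S e ≡ false ]
  ; end = end ∘ value
  } where open Graph G

K : ℕ → Graph
K m = record
  { V = Fin m ; #V = m ; V-enum = ↔-id (Fin m)
  ; E = [ p ∈ Fin m × Fin m ∣ proj₁ p Fin.< proj₂ p ]
  ; end = λ { e false → proj₁ (value e) ; e true → proj₂ (value e) }
  }

-- The data (C, v, f) of a map, together with a naming of its squares by
-- Fin #SQ: sq x is the square through the vertex x.  The squares of a map, of
-- its dual and of its phial have the same vertex sets, so the three share sq;
-- this is how their sets of squares are identified.
record Triple : Set₁ where
  field
    C   : Graph
  open Graph C public
  field
    v f : EdgeSet
    #SQ : ℕ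
    sq  : V → Fin #SQ

  a : EdgeSet
  a = ∁ (v ∪ f)

record IsMap (M : Triple) : Set where
  open Triple M
  field
    E-finite  : ∃[ k ] E ↔ Fin k
    cubic     : Cubic
    v-perfect : PerfectMatching v
    f-perfect : PerfectMatching f
    disjoint  : ∀ e → v e ∧ f e ≡ false
    -- v ∪ f is 2-regular, so a 4-cycle in it is a whole component.
    squares   : ∀ x → OnFourCycle (v ∪ f) x
    sq-onto   : ∀ s → ∃[ x ] sq x ≡ s
    sq-names  : ∀ x y → sq x ≡ sq y ⇔ Connected (v ∪ f) x y

dual : Triple → Triple
dual M = record { C = C ; v = f ; f = v ; #SQ = #SQ ; sq = sq }
  where open Triple M

module Phial (M : Triple) where
  open Triple M

  Opposite : Rel V 0ℓ
  Opposite x y = sq x ≡ sq y × x ≢ y × ¬ Adj (v ∪ f) x y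

  -- Listing the ends by increasing index gives each diagonal exactly once.
  Diagonal : Set
  Diagonal =
    [ p ∈ V × V ∣ index (proj₁ p) Fin.< index (proj₂ p)
                × Opposite (proj₁ p) (proj₂ p) ]

  Q : Graph
  Q = record
    { V = V ; #V = #V ; V-enum = V-enum
    ; E = E ⊎ Diagonal
    ; end = [ end
            , (λ { d false → proj₁ (value d) ; d true → proj₂ (value d) }) ]′
    }

  z : Graph.EdgeSet Q
  z = [ const false , const true ]′

  inQ : EdgeSet → Graph.EdgeSet Q
  inQ S = [ S , const false ]′

phial : Triple → Triple
phial M = record
  { C = Q ∖ inQ v ; v = z ∘ value ; f = inQ f ∘ value ; #SQ = #SQ ; sq = sq }
  where open Triple M ; open Phial M

-- G_X: its vertices are the cycles of v ∪ a, given as the vertices of C_X up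
-- to lying on the same cycle; its edges are the squares.
module G (X : Triple) where
  open Triple X

  Cycles : Setoid 0ℓ 0ℓ
  Cycles = EqC.setoid (Adj (v ∪ a))

  open Setoid Cycles public using () renaming (_≈_ to _~_)

  record Joins (s : Fin #SQ) (x y : V) : Set where
    field
      e₁ e₂    : E
      distinct : e₁ ≢ e₂
      e₁∈v     : v e₁ ≡ true
      e₂∈v     : v e₂ ≡ true
      e₁-in-s  : ∀ b → sq (end e₁ b) ≡ s
      e₂-in-s  : ∀ b → sq (end e₂ b) ≡ s
      e₁-on-x  : ∀ b → x ~ end e₁ b
      e₂-on-y  : ∀ b → y ~ end e₂ b

-- GF(2) is Bool with _xor_ and _∧_; a chain is a vector over the squares.
Chain : ℕ → Set
Chain m = Fin m → Bool

open Sum (CommutativeRing.+-commutativeMonoid xor-∧-commutativeRing)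
  using (sum) public

Coboundary : (X : Triple) → Pred (Chain (Triple.#SQ X)) 0ℓ
Coboundary X c = Σ[ w ∈ (V → Bool) ]
  (∀ x y → x ~ y → w x ≡ w y) ×
  (∀ s x y → Joins s x y → c s ≡ w x xor w y)
  where open Triple X ; open G X

_⊥ : ∀ {m} → Pred (Chain m) 0ℓ → Pred (Chain m) 0ℓ
(S ⊥) c = ∀ d → S d → sum (λ s → c s ∧ d s) ≡ false

_⊞_ : ∀ {m} → Pred (Chain m) 0ℓ → Pred (Chain m) 0ℓ → Pred (Chain m) 0ℓ
(S ⊞ T) c = ∃[ d ] ∃[ e ] S d × T e × (∀ s → c s ≡ d s xor e s)

-- The cycle space of G_M enters as the orthogonal complement of its
-- coboundary space.
Rich : Triple → Set
Rich M = (Coboundary M ⊥) ≐ (Coboundary (dual M) ⊞ Coboundary (phial M))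

-- Edges and their ends determine a graph, so it suffices that the two
-- bijections send each edge to a square joining the images of its ends.
record _≅G_ (H : Graph) (X : Triple) : Set where
  private module H = Graph H
  open Triple X
  open G X
  field
    vertices : Inverse (≡.setoid H.V) Cycles
    edges    : H.E ↔ Fin #SQ
    ends     : ∀ e → Joins (Inverse.to edges e)
                 (Inverse.to vertices (H.end e false))
                 (Inverse.to vertices (H.end e true))

MapRich : Graph → Set₁
MapRich H = Σ[ M ∈ Triple ] IsMap M × Rich M × (H ≅G M)

{-# OPTIONS --safe #-}

-- Read the squares of a map as the crossings of a family of closed curves, one
-- for each vertex of G_M: the faces and the zigzags of M are then the regions
-- of the two colours at every crossing.  For K_m take the m tangents at points
-- 0 , … , m - 1 of a conic in the projective plane: line i meets the other
-- lines in their cyclic order, and the four regions at the crossing of i and j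
-- are (i , j), (i + 1 , j), (i , j + 1) and (i + 1 , j + 1), coloured by the
-- parity of the sum of the coordinates.
--
-- A chain c is a symmetric matrix with zero diagonal, and it is orthogonal to
-- the coboundaries of G_M iff its rows sum to zero.  Let S a b be the sum of
-- the entries with row ≥ a and column ≥ b.  The second difference of S is c.
-- Moreover S is symmetric and vanishes on the diagonal and, the rows summing to
-- zero, on the border of the square 0 ≤ a , b ≤ m, so S is a function on the
-- regions.  Splitting the second difference by colour writes c as a coboundary
-- of the dual plus a coboundary of the phial.

module Submission where

open import Defs
open import Algebra.Bundles using (CommutativeRing)
import Algebra.Properties.CommutativeMonoid.Sum as Sum
open import Data.Bool using (Bool; true; false; not; _∧_; _xor_)
open import Data.Bool.Properties as Bool using (xor-∧-commutativeRing)
open import Data.Bool.Solver using (module xor-∧-Solver)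
open import Data.Empty using (⊥-elim-irr)
open import Data.Fin as Fin using (Fin; zero; suc; toℕ)
open import Data.Fin.Induction using (<-weakInduction)
open import Data.Fin.Patterns using (0F; 1F; 2F)
open import Data.Fin.Properties
  using (<-cmp; <-asym; <-irrefl; splitAt-↑ˡ; splitAt-↑ʳ; splitAt⁻¹-↑ˡ; splitAt⁻¹-↑ʳ;
         toℕ-inject₁; toℕ-fromℕ; *↔×; 2↔Bool; remQuot-combine)
open import Data.Fin.Relation.Unary.Top
  using (view; view-fromℕ; view-inject₁; ‵fromℕ; ‵inject₁)
open import Data.Irrelevant using ([_])
open import Data.List.Relation.Unary.All using ([]; _∷_)
open import Data.List.Relation.Unary.AllPairs using ([]; _∷_)
open import Data.Nat as ℕ using (ℕ; zero; suc; _*_; _≤_)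
open import Data.Nat.Properties using (+-suc; 1+n≢n)
open import Data.Product as Prod using (∃-syntax; _×_; _,_; proj₁; proj₂)
open import Data.Product.Function.NonDependent.Propositional using (_×-↔_)
import Data.Product.Properties as Prod
open import Data.Refinement using (value; _,_)
open import Data.Sum using (_⊎_; inj₁; inj₂; [_,_]′)
open import Function using (_∘_; _↔_; _⇔_; mk⇔; mk↔ₛ′; Inverse; Injection)
open import Function.Properties.Inverse using (↔-refl; ↔-sym; ↔-trans; ↔⇒↣)
open import Relation.Binary.Bundles using (Setoid)
import Relation.Binary.Construct.Closure.Equivalence as EqC
open import Relation.Binary.Definitions using (DecidableEquality; tri<; tri≈; tri>)
open import Relation.Binary.PropositionalEquality hiding ([_])
open import Relation.Nullary using (¬_; does; yes; no; contradiction)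
open import Relation.Nullary.Decidable using (dec-true; recompute)

open xor-∧-Solver using (solve; _:+_; _:*_; _:=_)
open Sum (CommutativeRing.+-commutativeMonoid xor-∧-commutativeRing)
  using (sum-cong-≗; ∑-distrib-+; sum-permute; ∑-comm)

-- Sums over GF(2)

sum-zero : ∀ {n} {f : Fin n → Bool} → (∀ i → f i ≡ false) → sum f ≡ false
sum-zero {zero}  p = refl
sum-zero {suc n} p = cong₂ _xor_ (p zero) (sum-zero (p ∘ suc))

sum-++ : ∀ m {n} (f : Fin (m ℕ.+ n) → Bool) →
         sum f ≡ sum (f ∘ (Fin._↑ˡ n)) xor sum (f ∘ (m Fin.↑ʳ_))
sum-++ zero    f = refl
sum-++ (suc m) f =
  trans (cong (f zero xor_) (sum-++ m (f ∘ suc))) (sym (Bool.xor-assoc (f zero) _ _))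

sum-combine : ∀ m {n} (f : Fin (m * n) → Bool) →
              sum f ≡ sum (λ i → sum (λ j → f (Fin.combine {m} i j)))
sum-combine zero        f = refl
sum-combine (suc m) {n} f =
  trans (sum-++ n f)
        (cong (sum (f ∘ (Fin._↑ˡ (m * n))) xor_) (sum-combine m (f ∘ (n Fin.↑ʳ_))))

-- Coboundaries of a presented map

-- Involutions describing a map: ν and α along v and a, and σ another
-- involution within the squares, so that a square is {x , ν x , σ x , ν (σ x)}.
record Presentation (X : Triple) : Set where
  open Triple X
  field
    ν α σ    : V → V
    v-flip   : ∀ e b → v e ≡ true → end e (not b) ≡ ν (end e b)
    a-flip   : ∀ e b → a e ≡ true → end e (not b) ≡ α (end e b)
    v-at     : ∀ x → ∃[ h ] v (proj₁ h) ≡ true × at h ≡ x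
    a-at     : ∀ x → ∃[ h ] a (proj₁ h) ≡ true × at h ≡ x
    v-unique : ∀ {e e′ b b′} → v e ≡ true → v e′ ≡ true →
               end e b ≡ end e′ b′ → e ≡ e′
    ν-sq     : ∀ x → sq (ν x) ≡ sq x
    σ-sq     : ∀ x → sq (σ x) ≡ sq x
    σ≢       : ∀ x → σ x ≢ x
    σ≢ν      : ∀ x → σ x ≢ ν x
    square   : ∀ {x y} → sq x ≡ sq y →
               y ≡ x ⊎ y ≡ ν x ⊎ y ≡ σ x ⊎ y ≡ ν (σ x)

module _ {X : Triple} (P : Presentation X) where
  open Triple X
  open G X
  open Presentation P
  open Setoid Cycles using () renaming (refl to ~-refl; sym to ~-sym; trans to ~-trans)

  v⇒v∪a : ∀ {e} → v e ≡ true → (v ∪ a) e ≡ true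
  v⇒v∪a {e} p rewrite p = refl

  a⇒v∪a : ∀ {e} → a e ≡ true → (v ∪ a) e ≡ true
  a⇒v∪a {e} p rewrite p = Bool.∨-zeroʳ (v e)

  v∪a-cases : ∀ {e} → (v ∪ a) e ≡ true → v e ≡ true ⊎ a e ≡ true
  v∪a-cases {e} p with v e
  ... | true  = inj₁ refl
  ... | false = inj₂ p

  ~ν : ∀ x → x ~ ν x
  ~ν x with (e , b) , p , refl ← v-at x =
    EqC.return (e , v⇒v∪a p , b , refl , v-flip e b p)

  ~α : ∀ x → x ~ α x
  ~α x with (e , b) , p , refl ← a-at x =
    EqC.return (e , a⇒v∪a p , b , refl , a-flip e b p)

  module _ {ℓ} {A : Set ℓ} (w : V → A)
           (wν : ∀ x → w (ν x) ≡ w x) (wα : ∀ x → w (α x) ≡ w x) where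

    ~-invariant : ∀ {x y} → x ~ y → w x ≡ w y
    ~-invariant = EqC.gfold isEquivalence w step
      where
      step : ∀ {x y} → Adj (v ∪ a) x y → w x ≡ w y
      step (e , p , b , refl , refl) with v∪a-cases p
      ... | inj₁ q = sym (trans (cong w (v-flip e b q)) (wν _))
      ... | inj₂ q = sym (trans (cong w (a-flip e b q)) (wα _))

  ends-of : ∀ {e x b} → v e ≡ true → end e b ≡ x →
            ∀ b′ → end e b′ ≡ x ⊎ end e b′ ≡ ν x
  ends-of {b = false} p q false = inj₁ q
  ends-of {b = false} p q true  = inj₂ (trans (v-flip _ false p) (cong ν q))
  ends-of {b = true}  p q true  = inj₁ q
  ends-of {b = true}  p q false = inj₂ (trans (v-flip _ true p) (cong ν q))

  -- The two edges are the v-edges at `x′` and `σ x′`; they differ because `σ x′` is neither `x′`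
  -- nor `ν x′`.
  joins : ∀ {s x y} x′ → sq x′ ≡ s → x ~ x′ → y ~ σ x′ → Joins s x y
  joins {s} {x} {y} x′ refl x~ y~
    with (e₁ , b₁) , p₁ , q₁ ← v-at x′ | (e₂ , b₂) , p₂ , q₂ ← v-at (σ x′) =
    record
      { e₁ = e₁ ; e₂ = e₂ ; distinct = distinct
      ; e₁∈v = p₁ ; e₂∈v = p₂
      ; e₁-in-s = λ b → in-s (ends-of p₁ q₁ b)
      ; e₂-in-s = λ b → trans (in-s (ends-of p₂ q₂ b)) (σ-sq x′)
      ; e₁-on-x = λ b → on x~ (ends-of p₁ q₁ b)
      ; e₂-on-y = λ b → on y~ (ends-of p₂ q₂ b)
      }
    where
    distinct : e₁ ≢ e₂
    distinct refl with ends-of p₁ q₁ b₂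
    ... | inj₁ q = σ≢ x′ (trans (sym q₂) q)
    ... | inj₂ q = σ≢ν x′ (trans (sym q₂) q)

    in-s : ∀ {p q} → p ≡ q ⊎ p ≡ ν q → sq p ≡ sq q
    in-s (inj₁ refl) = refl
    in-s (inj₂ refl) = ν-sq _

    on : ∀ {z p q} → z ~ q → p ≡ q ⊎ p ≡ ν q → z ~ p
    on z~ (inj₁ refl) = z~
    on z~ (inj₂ refl) = ~-trans z~ (~ν _)

  coboundary : ∀ {c} (w : V → Bool) →
               (∀ x → w (ν x) ≡ w x) → (∀ x → w (α x) ≡ w x) →
               (∀ x → c (sq x) ≡ w x xor w (σ x)) → Coboundary X c
  coboundary {c} w wν wα cw = w , (λ _ _ → inv) , λ s x y J → on-joins J
    where
    inv : ∀ {x y} → x ~ y → w x ≡ w y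
    inv = ~-invariant w wν wα

    on-joins : ∀ {s x y} → Joins s x y → c s ≡ w x xor w y
    on-joins {s} {x} {y} J = begin
      c s                    ≡⟨ cong c (e₁-in-s false) ⟨
      c (sq p)               ≡⟨ cw p ⟩
      w p xor w (σ p)        ≡⟨ cong (w p xor_) (sym wq) ⟩
      w p xor w q            ≡⟨ cong₂ _xor_ (inv (e₁-on-x false)) (inv (e₂-on-y false)) ⟨
      w x xor w y            ∎
      where
      open ≡-Reasoning
      open Joins J
      p q : V
      p = end e₁ false
      q = end e₂ false
      -- Since `e₂` differs from `e₁`, `v-unique` excludes `p` and `ν p` as values of `q`. The two
      -- flags left form the v-edge at `σ p`, along which `w` is constant.
      wq : w q ≡ w (σ p)
      wq with square (trans (e₁-in-s false) (sym (e₂-in-s false)))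
      ... | inj₁ r = contradiction (v-unique e₁∈v e₂∈v (sym r)) distinct
      ... | inj₂ (inj₁ r) = contradiction
              (v-unique e₁∈v e₂∈v (trans (v-flip e₁ false e₁∈v) (sym r))) distinct
      ... | inj₂ (inj₂ (inj₁ r)) = cong w r
      ... | inj₂ (inj₂ (inj₂ r)) = trans (cong w r) (wν _)

  coboundary⁻¹ : ∀ {c} → Coboundary X c → ∃[ w ]
                 (∀ x → w (ν x) ≡ w x) × (∀ x → w (α x) ≡ w x) ×
                 (∀ x → c (sq x) ≡ w x xor w (σ x))
  coboundary⁻¹ (w , inv , cw) =
    w , (λ x → sym (inv _ _ (~ν x))) , (λ x → sym (inv _ _ (~α x))) ,
    λ x → cw (sq x) x (σ x) (joins x refl ~-refl ~-refl)

-- Boolean identities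

uip : ∀ {A : Set} {x y : A} (p q : x ≡ y) → p ≡ q
uip refl refl = refl

≡⊎≡not : ∀ x y → y ≡ x ⊎ y ≡ not x
≡⊎≡not false false = inj₁ refl
≡⊎≡not false true  = inj₂ refl
≡⊎≡not true  false = inj₂ refl
≡⊎≡not true  true  = inj₁ refl

≢not : ∀ {b} → b ≢ not b
≢not = Bool.not-¬ refl

abstract

  xor-cancelʳ : ∀ x y → (x xor y) xor y ≡ x
  xor-cancelʳ = solve 2 (λ x y → (x :+ y) :+ y := x) refl

  xor-interchange : ∀ a b c d → (a xor b) xor (c xor d) ≡ (a xor c) xor (b xor d)
  xor-interchange =
    solve 4 (λ a b c d → (a :+ b) :+ (c :+ d) := (a :+ c) :+ (b :+ d)) refl

  ∧-exchange : ∀ x y z → x ∧ (y ∧ z) ≡ y ∧ (x ∧ z)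
  ∧-exchange = solve 3 (λ x y z → x :* (y :* z) := y :* (x :* z)) refl

  xor-move : ∀ β ε x y → β xor (ε xor (x xor y)) ≡ β xor (x xor (ε xor y))
  xor-move = solve 4 (λ β ε x y → β :+ (ε :+ (x :+ y)) := β :+ (x :+ (ε :+ y))) refl

  xor-collapse : ∀ β ε x y → β xor (y xor ((β xor (ε xor (x xor y))) xor x)) ≡ ε
  xor-collapse =
    solve 4 (λ β ε x y → β :+ (y :+ ((β :+ (ε :+ (x :+ y))) :+ x)) := ε) refl

  xor-pair-diagonals : ∀ x y z u → (x xor y) xor (z xor u) ≡ (x xor u) xor (y xor z)
  xor-pair-diagonals =
    solve 4 (λ x y z u → (x :+ y) :+ (z :+ u) := (x :+ u) :+ (y :+ z)) refl

-- Maps given by a twist of each square and a permutation of the darts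

-- A dart (s , b) is the square s together with one of its two v-edges; a flag
-- is one of the two ends of that v-edge.
module Flags (N : ℕ) (twist : Fin N → Bool) where

  Dart Flag : Set
  Dart = Fin N × Bool
  Flag = Dart × Bool

  square-of : Flag → Fin N
  square-of ((s , _) , _) = s

  -- These will be the involutions along v, f and z. The ends of the two v-edges of a square can be
  -- paired across in two ways; `twist` says which of them is f, and the other is z.
  ν φ ζ : Flag → Flag
  ν (d , ε) = d , not ε
  φ ((s , b) , ε) = (s , not b) , (ε xor twist s)
  ζ x = ν (φ x)

  φν≗ζ : ∀ x → φ (ν x) ≡ ζ x
  φν≗ζ ((s , b) , ε) = cong (_ ,_) (sym (Bool.not-distribˡ-xor ε (twist s)))

  ν-involutive : ∀ x → ν (ν x) ≡ x
  ν-involutive (d , ε) = cong (d ,_) (Bool.not-involutive ε)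

  φ-involutive : ∀ x → φ (φ x) ≡ x
  φ-involutive ((s , b) , ε) =
    cong₂ (λ b ε → (s , b) , ε) (Bool.not-involutive b) (xor-cancelʳ ε (twist s))

  ζν≗φ : ∀ x → ζ (ν x) ≡ φ x
  ζν≗φ x = trans (cong ν (φν≗ζ x)) (ν-involutive (φ x))

  ζ-involutive : ∀ x → ζ (ζ x) ≡ x
  ζ-involutive x = trans (ζν≗φ (φ x)) (φ-involutive x)

  same-square : ∀ x y → square-of x ≡ square-of y →
                y ≡ x ⊎ y ≡ ν x ⊎ y ≡ φ x ⊎ y ≡ ζ x
  same-square ((s , b) , ε) ((_ , b′) , ε′) refl with ≡⊎≡not b b′
  ... | inj₁ refl with ≡⊎≡not ε ε′
  ...   | inj₁ refl = inj₁ refl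
  ...   | inj₂ refl = inj₂ (inj₁ refl)
  same-square ((s , b) , ε) ((_ , b′) , ε′) refl | inj₂ refl
    with ≡⊎≡not (ε xor twist s) ε′
  ...   | inj₁ refl = inj₂ (inj₂ (inj₁ refl))
  ...   | inj₂ refl = inj₂ (inj₂ (inj₂ refl))

  end≢ : ∀ {x y : Flag} → proj₂ (proj₁ x) ≡ not (proj₂ (proj₁ y)) → x ≢ y
  end≢ p refl = ≢not p

  ν≢ : ∀ x → ν x ≢ x
  ν≢ x p = ≢not (sym (cong proj₂ p))

  φ≢ : ∀ x → φ x ≢ x
  φ≢ x = end≢ refl

  φ≢ν : ∀ x → φ x ≢ ν x
  φ≢ν x = end≢ refl

  ζ≢ : ∀ x → ζ x ≢ x
  ζ≢ x = end≢ refl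

  ζ≢ν : ∀ x → ζ x ≢ ν x
  ζ≢ν x = end≢ refl

  ζ≢φ : ∀ x → ζ x ≢ φ x
  ζ≢φ x = ν≢ (φ x)

  Dart-enum : Fin (N * 2) ↔ Dart
  Dart-enum = ↔-trans *↔× (↔-refl ×-↔ 2↔Bool)

  Flag-enum : Flag ↔ Fin (N * 2 * 2)
  Flag-enum = ↔-sym (↔-trans *↔× (Dart-enum ×-↔ 2↔Bool))

-- The map on these flags in which the a-edges join the positive end of each
-- dart d to the negative end of next d.
module DartMap (N : ℕ) (twist : Fin N → Bool)
               (next prev : Fin N × Bool → Fin N × Bool)
               (next-prev : ∀ d → next (prev d) ≡ d)
               (prev-next : ∀ d → prev (next d) ≡ d) where

  open Flags N twist public

  Edge : Set
  Edge = Fin 3 × Dart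

  pattern vᵏ = 0F
  pattern fᵏ = 1F
  pattern aᵏ = 2F

  -- Edges of all three kinds are named by darts. For f the second component is an end rather than a
  -- choice of v-edge: `(s , ε)` names the f-edge that meets the v-edge `(s , false)` in its end
  -- `ε`.
  ends : Edge → Bool → Flag
  ends (vᵏ , d) β = d , β
  ends (fᵏ , (s , ε)) β = (s , β) , (ε xor (β ∧ twist s))
  ends (aᵏ , d) true = d , true
  ends (aᵏ , d) false = next d , false

  α : Flag → Flag
  α (d , true) = next d , false
  α (d , false) = prev d , true

  mate : Fin 3 → Flag → Flag
  mate vᵏ = ν
  mate fᵏ = φ
  mate aᵏ = α

  ends-not : ∀ k d b → ends (k , d) (not b) ≡ mate k (ends (k , d) b)
  ends-not vᵏ d b = refl
  ends-not fᵏ (s , ε) false =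
    cong (λ ε → (s , true) , (ε xor twist s)) (sym (Bool.xor-identityʳ ε))
  ends-not fᵏ (s , ε) true =
    cong ((s , false) ,_) (trans (Bool.xor-identityʳ ε) (sym (xor-cancelʳ ε (twist s))))
  ends-not aᵏ d false = cong (_, true) (sym (prev-next d))
  ends-not aᵏ d true = refl

  -- The one half-edge of each kind at a flag. `kind-half`, `at-half` and `half-at` make this a
  -- bijection, from which cubicity and both perfect matchings are read off.
  half : Fin 3 → Flag → Edge × Bool
  half vᵏ (d , ε) = (vᵏ , d) , ε
  half fᵏ ((s , b) , ε) = (fᵏ , (s , ε xor (b ∧ twist s))) , b
  half aᵏ (d , true) = (aᵏ , d) , true
  half aᵏ (d , false) = (aᵏ , prev d) , false

  kind : Edge × Bool → Fin 3
  kind ((k , _) , _) = k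

  kind-half : ∀ k x → kind (half k x) ≡ k
  kind-half vᵏ x = refl
  kind-half fᵏ x = refl
  kind-half aᵏ (d , true) = refl
  kind-half aᵏ (d , false) = refl

  at-half : ∀ k x → ends (proj₁ (half k x)) (proj₂ (half k x)) ≡ x
  at-half vᵏ x = refl
  at-half fᵏ ((s , b) , ε) = cong ((s , b) ,_) (xor-cancelʳ ε (b ∧ twist s))
  at-half aᵏ (d , true) = refl
  at-half aᵏ (d , false) = cong (_, false) (next-prev d)

  half-at : ∀ k d b → half k (ends (k , d) b) ≡ ((k , d) , b)
  half-at vᵏ d b = refl
  half-at fᵏ (s , ε) b = cong (λ ε → (fᵏ , (s , ε)) , b) (xor-cancelʳ ε (b ∧ twist s))
  half-at aᵏ d false = cong (λ d → (aᵏ , d) , false) (prev-next d)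
  half-at aᵏ d true = refl

  is : Fin 3 → Edge → Bool
  is k (k′ , _) = does (k Fin.≟ k′)

  C : Graph
  C = record
    { V = Flag ; #V = N * 2 * 2 ; V-enum = Flag-enum
    ; E = Edge ; end = ends }

  M : Triple
  M = record { C = C ; v = is vᵏ ; f = is fᵏ ; #SQ = N ; sq = square-of }

  open Triple M using (Cubic; PerfectMatching; OnFourCycle; Connected; Adj; a; _∪_; at)

  cubic : Cubic
  cubic x = mk↔ₛ′ (kind ∘ proj₁) (λ k → half k x , at-half k x) (λ k → kind-half k x)
    λ { (((k , d) , b) , refl) → unique (at-half k _) refl (half-at k d b) }
    where
    unique : ∀ {h h′} (p : at h ≡ x) (p′ : at h′ ≡ x) → h ≡ h′ → (h , p) ≡ (h′ , p′)
    unique p p′ refl = cong (_ ,_) (uip p p′)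

  is⇒≡ : ∀ k {k′ d} → is k (k′ , d) ≡ true → k′ ≡ k
  is⇒≡ k {k′} p with k Fin.≟ k′
  ... | yes refl = refl

  is-half : ∀ k x → is k (proj₁ (half k x)) ≡ true
  is-half k x rewrite kind-half k x = dec-true (k Fin.≟ k) refl

  perfect : ∀ k → PerfectMatching (is k)
  perfect k x = half k x , (is-half k x , at-half k x) , unique
    where
    unique : ∀ {h} → is k (proj₁ h) ≡ true × at h ≡ x → half k x ≡ h
    unique {(k′ , d) , b} (p , refl) with refl ← is⇒≡ k {k′} {d} p = half-at k d b

  adj-ν : ∀ x → Adj (is vᵏ ∪ is fᵏ) x (ν x)
  adj-ν x = proj₁ (half vᵏ x) , refl , proj₂ (half vᵏ x) , at-half vᵏ x , refl

  adj-φ : ∀ x → Adj (is vᵏ ∪ is fᵏ) x (φ x)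
  adj-φ x@((s , b) , ε) = proj₁ (half fᵏ x) , refl , b , at-half fᵏ x ,
    trans (ends-not fᵏ (s , ε xor (b ∧ twist s)) b) (cong φ (at-half fᵏ x))

  adj-cases : ∀ {x y} → Adj (is vᵏ ∪ is fᵏ) x y → y ≡ ν x ⊎ y ≡ φ x
  adj-cases ((vᵏ , d) , p , b , refl , refl) = inj₁ refl
  adj-cases ((fᵏ , d) , p , b , refl , refl) = inj₂ (ends-not fᵏ d b)

  four-cycle : ∀ x → OnFourCycle (is vᵏ ∪ is fᵏ) x
  four-cycle x = ν x , φ (ν x) , ν (φ (ν x)) ,
    ((≢-sym (ν≢ x) ∷ end≢ (sym (Bool.not-involutive _)) ∷ end≢ (sym (Bool.not-involutive _)) ∷ [])
      ∷ (≢-sym (φ≢ (ν x)) ∷ ≢-sym (ζ≢ (ν x)) ∷ [])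
      ∷ (≢-sym (ν≢ (φ (ν x))) ∷ []) ∷ [] ∷ []) ,
    adj-ν x , adj-φ (ν x) , adj-ν (φ (ν x)) ,
    -- The fourth flag `ζ (ν x)` is `φ x`, so `φ` leads back to `x`.
    subst (Adj _ _) (trans (cong φ (ζν≗φ x)) (φ-involutive x)) (adj-φ (ζ (ν x)))

  connected⇔ : ∀ x y → square-of x ≡ square-of y ⇔ Connected (is vᵏ ∪ is fᵏ) x y
  connected⇔ x y = mk⇔ to (EqC.gfold isEquivalence square-of from)
    where
    to : square-of x ≡ square-of y → Connected (is vᵏ ∪ is fᵏ) x y
    to p with same-square x y p
    ... | inj₁ refl = EqC.reflexive _
    ... | inj₂ (inj₁ refl) = EqC.return (adj-ν x)
    ... | inj₂ (inj₂ (inj₁ refl)) = EqC.return (adj-φ x)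
    ... | inj₂ (inj₂ (inj₂ refl)) =
      EqC.transitive _ (EqC.return (adj-φ x)) (EqC.return (adj-ν (φ x)))
    from : ∀ {x y} → Adj (is vᵏ ∪ is fᵏ) x y → square-of x ≡ square-of y
    from p with adj-cases p
    ... | inj₁ refl = refl
    ... | inj₂ refl = refl

  isMap : IsMap M
  isMap = record
    { E-finite  = 3 * (N * 2) , ↔-sym (↔-trans *↔× (↔-refl ×-↔ Dart-enum))
    ; cubic     = cubic
    ; v-perfect = perfect vᵏ
    ; f-perfect = perfect fᵏ
    ; disjoint  = λ { (vᵏ , d) → refl ; (fᵏ , d) → refl ; (aᵏ , d) → refl }
    ; squares   = four-cycle
    ; sq-onto   = λ s → ((s , false) , false) , refl
    ; sq-names  = connected⇔
    }

  -- Presentations of the map, its dual and its phial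

  flip : ∀ k e b → is k e ≡ true → ends e (not b) ≡ mate k (ends e b)
  flip k (k′ , d) b p with refl ← is⇒≡ k {k′} {d} p = ends-not k d b

  is-unique : ∀ k {e e′ b b′} → is k e ≡ true → is k e′ ≡ true →
              ends e b ≡ ends e′ b′ → e ≡ e′
  is-unique k {k₁ , d} {k₂ , d′} {b} {b′} p p′ q
    with refl ← is⇒≡ k {k₁} {d} p | refl ← is⇒≡ k {k₂} {d′} p′ =
    cong proj₁ (trans (sym (half-at k d b)) (trans (cong (half k) q) (half-at k d′ b′)))

  a⇒is : ∀ e → a e ≡ true → is aᵏ e ≡ true
  a⇒is (aᵏ , d) p = refl

  a-half : ∀ x → a (proj₁ (half aᵏ x)) ≡ true
  a-half (d , true) = refl
  a-half (d , false) = refl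

  presentation : Presentation M
  presentation = record
    { ν = ν ; α = α ; σ = φ
    ; v-flip = flip vᵏ
    ; a-flip = λ e b p → flip aᵏ e b (a⇒is e p)
    ; v-at = λ x → half vᵏ x , is-half vᵏ x , at-half vᵏ x
    ; a-at = λ x → half aᵏ x , a-half x , at-half aᵏ x
    ; v-unique = is-unique vᵏ
    ; ν-sq = λ _ → refl ; σ-sq = λ _ → refl
    ; σ≢ = φ≢ ; σ≢ν = φ≢ν
    ; square = λ {x} {y} → same-square x y
    }

  -- Both here and for the phial σ is `ν`, so that a coboundary of either is `w x xor w (ν x)` on
  -- the square of `x` and one computation serves both.
  dual-presentation : Presentation (dual M)
  dual-presentation = record
    { ν = φ ; α = α ; σ = ν
    ; v-flip = flip fᵏ
    ; a-flip = λ { e@(aᵏ , d) b p → flip aᵏ e b refl }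
    ; v-at = λ x → half fᵏ x , is-half fᵏ x , at-half fᵏ x
    ; a-at = λ { x@(d , true) → half aᵏ x , refl , refl
               ; x@(d , false) → half aᵏ x , refl , at-half aᵏ x }
    ; v-unique = is-unique fᵏ
    ; ν-sq = λ _ → refl ; σ-sq = λ _ → refl
    ; σ≢ = ν≢ ; σ≢ν = λ x → ≢-sym (φ≢ν x)
    ; square = λ {x} {y} p → reorder x (same-square x y p)
    }
    where
    reorder : ∀ x {y} → y ≡ x ⊎ y ≡ ν x ⊎ y ≡ φ x ⊎ y ≡ ζ x →
              y ≡ x ⊎ y ≡ φ x ⊎ y ≡ ν x ⊎ y ≡ φ (ν x)
    reorder x (inj₁ p) = inj₁ p
    reorder x (inj₂ (inj₁ p)) = inj₂ (inj₂ (inj₁ p))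
    reorder x (inj₂ (inj₂ (inj₁ p))) = inj₂ (inj₁ p)
    reorder x (inj₂ (inj₂ (inj₂ p))) = inj₂ (inj₂ (inj₂ (trans p (sym (φν≗ζ x)))))

  open Phial M using (Opposite; Diagonal; Q)
  open Graph C using (index)

  _≟ᶠ_ : DecidableEquality Flag
  _≟ᶠ_ = Prod.≡-dec (Prod.≡-dec Fin._≟_ Bool._≟_) Bool._≟_

  opposite-ζ : ∀ x → Opposite x (ζ x)
  opposite-ζ x = refl , ≢-sym (ζ≢ x) , λ A → not-adj (adj-cases A)
    where
    not-adj : ¬ (ζ x ≡ ν x ⊎ ζ x ≡ φ x)
    not-adj (inj₁ p) = ζ≢ν x p
    not-adj (inj₂ p) = ζ≢φ x p

  -- Of the four flags of the square only `ζ x` is neither `x` nor adjacent to it. Diagonals carry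
  -- their proofs irrelevantly, so the equation is recovered by deciding equality of flags.
  opposite⇒ζ : ∀ {x y} → .(Opposite x y) → y ≡ ζ x
  opposite⇒ζ {x} {y} o = recompute (y ≟ᶠ ζ x) (relevant o)
    where
    relevant : Opposite x y → y ≡ ζ x
    relevant (p , x≢y , ¬A) with same-square x y p
    ... | inj₁ refl = contradiction refl x≢y
    ... | inj₂ (inj₁ refl) = contradiction (adj-ν x) ¬A
    ... | inj₂ (inj₂ (inj₁ refl)) = contradiction (adj-φ x) ¬A
    ... | inj₂ (inj₂ (inj₂ q)) = q

  diagonal-ends : Diagonal → Bool → Flag
  diagonal-ends d = Graph.end Q (inj₂ d)

  diagonal-flip : ∀ d b → diagonal-ends d (not b) ≡ ζ (diagonal-ends d b)
  diagonal-flip (p , [ o ]) false = opposite⇒ζ (proj₂ o)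
  diagonal-flip (p , [ o ]) true =
    sym (trans (cong ζ (opposite⇒ζ (proj₂ o))) (ζ-involutive _))

  -- Whichever of `x` and `ζ x` has the smaller index comes first; a tie is impossible, as the
  -- enumeration is injective and `ζ` has no fixed point.
  diagonal-at : ∀ x → ∃[ d ] ∃[ b ] diagonal-ends d b ≡ x
  diagonal-at x with <-cmp (index x) (index (ζ x))
  ... | tri< p _ _ = ((x , ζ x) , [ p , opposite-ζ x ]) , false , refl
  ... | tri≈ _ p _ = contradiction (sym (Injection.injective (↔⇒↣ Flag-enum) p)) (ζ≢ x)
  ... | tri> _ _ p = ((ζ x , x) , [ p , opposite ]) , true , refl
    where
    opposite : Opposite (ζ x) x
    opposite = subst (Opposite (ζ x)) (ζ-involutive x) (opposite-ζ (ζ x))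

  -- A common end forces the other ends to agree through `ζ`. If the two ends played opposite roles,
  -- the two diagonals would list them in contradictory orders.
  diagonal-unique : ∀ {d d′ b b′} → diagonal-ends d b ≡ diagonal-ends d′ b′ → d ≡ d′
  diagonal-unique {d} {d′} {false} {false} refl
    with refl ← trans (diagonal-flip d false) (sym (diagonal-flip d′ false)) = refl
  diagonal-unique {d} {d′} {true} {true} refl
    with refl ← trans (diagonal-flip d true) (sym (diagonal-flip d′ true)) = refl
  diagonal-unique {d@(_ , [ p ])} {d′@(_ , [ p′ ])} {false} {true} refl
    with refl ← trans (diagonal-flip d false) (sym (diagonal-flip d′ true)) =
    ⊥-elim-irr (<-asym (proj₁ p) (proj₁ p′))
  diagonal-unique {d@(_ , [ p ])} {d′@(_ , [ p′ ])} {true} {false} refl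
    with refl ← trans (diagonal-flip d true) (sym (diagonal-flip d′ false)) =
    ⊥-elim-irr (<-asym (proj₁ p) (proj₁ p′))

  phial-presentation : Presentation (phial M)
  phial-presentation = record
    { ν = ζ ; α = α ; σ = ν
    ; v-flip = λ { (inj₂ d , _) b p → diagonal-flip d b }
    -- Outside z and f the phial keeps just the a-edges of `M`, its v-edges having been deleted.
    ; a-flip = λ { (inj₁ e@(vᵏ , d) , [ () ]) b p
               ; (inj₁ e@(aᵏ , d) , _) b p → flip aᵏ e b refl }
    ; v-at = v-at
    ; a-at = a-at
    ; v-unique = λ { {inj₂ d , _} {inj₂ d′ , _} {b} {b′} p p′ q →
        cong (λ d → inj₂ d , [ refl ]) (diagonal-unique {b = b} {b′} q) }
    ; ν-sq = λ _ → refl ; σ-sq = λ _ → refl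
    ; σ≢ = ν≢ ; σ≢ν = λ x → ≢-sym (ζ≢ν x)
    ; square = λ {x} {y} p → reorder x (same-square x y p)
    }
    where
    module P = Triple (phial M)
    v-at : ∀ x → ∃[ h ] P.v (proj₁ h) ≡ true × P.at h ≡ x
    v-at x with d , b , p ← diagonal-at x = ((inj₂ d , [ refl ]) , b) , refl , p

    a-at : ∀ x → ∃[ h ] P.a (proj₁ h) ≡ true × P.at h ≡ x
    a-at x@(d , true) = ((inj₁ (aᵏ , d) , [ refl ]) , true) , refl , refl
    a-at x@(d , false) = ((inj₁ (aᵏ , prev d) , [ refl ]) , false) , refl , at-half aᵏ x

    reorder : ∀ x {y} → y ≡ x ⊎ y ≡ ν x ⊎ y ≡ φ x ⊎ y ≡ ζ x →
              y ≡ x ⊎ y ≡ ζ x ⊎ y ≡ ν x ⊎ y ≡ ζ (ν x)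
    reorder x (inj₁ p) = inj₁ p
    reorder x (inj₂ (inj₁ p)) = inj₂ (inj₂ (inj₁ p))
    reorder x (inj₂ (inj₂ (inj₁ p))) = inj₂ (inj₂ (inj₂ (trans p (sym (ζν≗φ x)))))
    reorder x (inj₂ (inj₂ (inj₂ p))) = inj₂ (inj₁ p)

  -- Coboundaries of the dual and of the phial are cycles

  ∑-dart : (Dart → Bool) → Bool
  ∑-dart g = sum λ s → g (s , false) xor g (s , true)

  ∑-dart-enum : ∀ g → ∑-dart g ≡ sum (g ∘ Inverse.to Dart-enum)
  ∑-dart-enum g = sym (trans (sum-combine N _) (sum-cong-≗ λ s → cong₂ _xor_
    (cong g (to-combine s 0F))
    (trans (Bool.xor-identityʳ _) (cong g (to-combine s 1F)))))
    where
    to-combine : ∀ s (j : Fin 2) →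
                 Inverse.to Dart-enum (Fin.combine s j) ≡ (s , Inverse.to 2↔Bool j)
    to-combine s j = cong (λ (s , j) → s , Inverse.to 2↔Bool j) (remQuot-combine s j)

  ∑-dart-next : ∀ g → ∑-dart (g ∘ next) ≡ ∑-dart g
  ∑-dart-next g = begin
    ∑-dart (g ∘ next)            ≡⟨ ∑-dart-enum (g ∘ next) ⟩
    sum (g ∘ next ∘ to)          ≡⟨ sum-cong-≗ (λ k → cong g (strictlyInverseˡ (next (to k)))) ⟨
    sum (g ∘ to ∘ Inverse.to π)  ≡⟨ sum-permute (g ∘ to) π ⟨
    sum (g ∘ to)                 ≡⟨ ∑-dart-enum g ⟨
    ∑-dart g                     ∎
    where
    open ≡-Reasoning
    open Inverse Dart-enum using (to; strictlyInverseˡ)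
    π : Fin (N * 2) ↔ Fin (N * 2)
    π = ↔-trans Dart-enum (↔-trans (mk↔ₛ′ next prev next-prev prev-next) (↔-sym Dart-enum))

  -- Summing d ∧ b over the squares counts every flag value w x ∧ u x once, and
  -- the flags cancel in the pairs joined by a-edges.
  orthogonal : ∀ {c b : Chain N} (w u : Flag → Bool) →
               (∀ x → w (α x) ≡ w x) → (∀ x → u (ν x) ≡ u x) → (∀ x → u (α x) ≡ u x) →
               (∀ x → c (square-of x) ≡ w x xor w (ν x)) →
               (∀ x → b (square-of x) ≡ u x xor u (φ x)) →
               sum (λ s → c s ∧ b s) ≡ false
  orthogonal {c} {b} w u wα uν uα cw bu = begin
    sum (λ s → c s ∧ b s)                 ≡⟨ sum-cong-≗ on-square ⟩
    ∑-dart (λ d → h (d , true) xor h (d , false))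
      ≡⟨ sum-cong-≗ (λ s → xor-interchange (h ((s , false) , true)) _ _ _) ⟩
    sum (λ s → (h ((s , false) , true) xor h ((s , true) , true))
           xor (h ((s , false) , false) xor h ((s , true) , false)))
      ≡⟨ ∑-distrib-+ (λ s → h ((s , false) , true) xor h ((s , true) , true)) _ ⟩
    ∑-dart (λ d → h (d , true)) xor ∑-dart (λ d → h (d , false))
      ≡⟨ cong (_xor negative) (sum-cong-≗ λ s → cong₂ _xor_ (hα (s , false)) (hα (s , true))) ⟩
    ∑-dart (λ d → h (next d , false)) xor ∑-dart (λ d → h (d , false))
      ≡⟨ cong (_xor negative) (∑-dart-next (λ d → h (d , false))) ⟩
    ∑-dart (λ d → h (d , false)) xor ∑-dart (λ d → h (d , false))
      ≡⟨ Bool.xor-same negative ⟩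
    false ∎
    where
    open ≡-Reasoning
    h : Flag → Bool
    h x = w x ∧ u x

    negative : Bool
    negative = ∑-dart (λ d → h (d , false))

    hα : ∀ d → h (d , true) ≡ h (next d , false)
    hα d = sym (cong₂ _∧_ (wα (d , true)) (uα (d , true)))

    u-dart : ∀ d ε → u (d , ε) ≡ u (d , true)
    u-dart d true  = refl
    u-dart d false = uν (d , true)

    -- The chain `c` is the difference of `w` along either v-edge of the square, and `u` is constant
    -- on that v-edge.
    on-dart : ∀ d → c (proj₁ d) ∧ u (d , true) ≡ h (d , true) xor h (d , false)
    on-dart d = begin
      c (proj₁ d) ∧ u (d , true)
        ≡⟨ cong (_∧ _) (cw (d , true)) ⟩
      (w (d , true) xor w (d , false)) ∧ u (d , true)
        ≡⟨ Bool.∧-distribʳ-xor (u (d , true)) (w (d , true)) _ ⟩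
      h (d , true) xor (w (d , false) ∧ u (d , true))
        ≡⟨ cong (λ b → h (d , true) xor (w (d , false) ∧ b)) (u-dart d false) ⟨
      h (d , true) xor h (d , false)                    ∎

    on-square : ∀ s → c s ∧ b s ≡ (h ((s , false) , true) xor h ((s , false) , false))
                              xor (h ((s , true) , true) xor h ((s , true) , false))
    on-square s = begin
      c s ∧ b s
        ≡⟨ cong (c s ∧_) (trans (bu ((s , false) , true))
             (cong (u ((s , false) , true) xor_) (u-dart (s , true) _))) ⟩
      c s ∧ (u ((s , false) , true) xor u ((s , true) , true))
        ≡⟨ Bool.∧-distribˡ-xor (c s) _ _ ⟩
      (c s ∧ u ((s , false) , true)) xor (c s ∧ u ((s , true) , true))
        ≡⟨ cong₂ _xor_ (on-dart (s , false)) (on-dart (s , true)) ⟩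
      _ ∎

  -- This half of richness holds for every map of this form; complete graphs enter only in the
  -- converse.
  dual⊞phial⊆⊥ : ∀ {c} → (Coboundary (dual M) ⊞ Coboundary (phial M)) c → (Coboundary M ⊥) c
  dual⊞phial⊆⊥ {c} (d , e , D , E , c≗) b B
    with w , _ , wα , dw ← coboundary⁻¹ dual-presentation D
       | w′ , _ , wα′ , ew′ ← coboundary⁻¹ phial-presentation E
       | u , uν , uα , bu ← coboundary⁻¹ presentation B = begin
    sum (λ s → c s ∧ b s)
      ≡⟨ sum-cong-≗ (λ s → trans (cong (_∧ b s) (c≗ s)) (Bool.∧-distribʳ-xor (b s) (d s) (e s))) ⟩
    sum (λ s → (d s ∧ b s) xor (e s ∧ b s))
      ≡⟨ ∑-distrib-+ (λ s → d s ∧ b s) _ ⟩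
    sum (λ s → d s ∧ b s) xor sum (λ s → e s ∧ b s)
      ≡⟨ cong₂ _xor_ (orthogonal w u wα uν uα dw bu) (orthogonal w′ u wα′ uν uα ew′ bu) ⟩
    false ∎
    where open ≡-Reasoning

-- Pairs of lines and symmetric matrices

#pairs : ℕ → ℕ
#pairs zero    = zero
#pairs (suc m) = m ℕ.+ #pairs m

-- The first `m` squares pair line `zero` with each other line; the rest are the pairs among those
-- other lines.
lo hi : ∀ {m} → Fin (#pairs m) → Fin m
lo {suc m} s = [ (λ _ → zero) , suc ∘ lo {m} ]′ (Fin.splitAt m s)
hi {suc m} s = [ suc , suc ∘ hi {m} ]′ (Fin.splitAt m s)

lo<hi : ∀ {m} (s : Fin (#pairs m)) → lo {m} s Fin.< hi {m} s
lo<hi {suc m} s with Fin.splitAt m s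
... | inj₁ j = ℕ.z<s
... | inj₂ t = ℕ.s<s (lo<hi {m} t)

PairDart : ℕ → Set
PairDart m = Fin (#pairs m) × Bool

-- `tail` is the line that carries the v-edge, `head` the line crossed there.
tail head : ∀ {m} → PairDart m → Fin m
tail {m} (s , false) = lo {m} s
tail {m} (s , true)  = hi {m} s
head {m} (s , b) = tail {m} (s , not b)

tail≢head : ∀ {m} (d : PairDart m) → tail {m} d ≢ head {m} d
tail≢head {m} (s , false) p = <-irrefl p (lo<hi {m} s)
tail≢head {m} (s , true)  p = <-irrefl (sym p) (lo<hi {m} s)

-- Irrelevance of the inequality lets `dart-cong` compare darts by their lines alone.
dart : ∀ {m} (i j : Fin m) → .(i ≢ j) → PairDart m
dart zero zero p = ⊥-elim-irr (p refl)
dart {suc m} zero (suc j) p = j Fin.↑ˡ #pairs m , false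
dart {suc m} (suc i) zero p = i Fin.↑ˡ #pairs m , true
dart {suc m} (suc i) (suc j) p = Prod.map₁ (m Fin.↑ʳ_) (dart i j (p ∘ cong suc))

tail-↑ʳ : ∀ m (d : PairDart m) → tail {suc m} (Prod.map₁ (m Fin.↑ʳ_) d) ≡ suc (tail {m} d)
tail-↑ʳ m (s , false) rewrite splitAt-↑ʳ m (#pairs m) s = refl
tail-↑ʳ m (s , true)  rewrite splitAt-↑ʳ m (#pairs m) s = refl

tail-dart : ∀ {m} (i j : Fin m) .(p : i ≢ j) → tail {m} (dart i j p) ≡ i
tail-dart zero zero p = ⊥-elim-irr (p refl)
tail-dart {suc m} zero (suc j) p rewrite splitAt-↑ˡ m j (#pairs m) = refl
tail-dart {suc m} (suc i) zero p rewrite splitAt-↑ˡ m i (#pairs m) = refl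
tail-dart {suc m} (suc i) (suc j) p =
  trans (tail-↑ʳ m (dart i j _)) (cong suc (tail-dart i j _))

head-dart : ∀ {m} (i j : Fin m) .(p : i ≢ j) → head {m} (dart i j p) ≡ j
head-dart zero zero p = ⊥-elim-irr (p refl)
head-dart {suc m} zero (suc j) p rewrite splitAt-↑ˡ m j (#pairs m) = refl
head-dart {suc m} (suc i) zero p rewrite splitAt-↑ˡ m i (#pairs m) = refl
head-dart {suc m} (suc i) (suc j) p =
  trans (tail-↑ʳ m (Prod.map₂ not (dart i j _))) (cong suc (head-dart i j _))

dart-cong : ∀ {m} {i i′ j j′ : Fin m} .{p : i ≢ j} .{p′ : i′ ≢ j′} →
            i ≡ i′ → j ≡ j′ → dart i j p ≡ dart i′ j′ p′
dart-cong refl refl = refl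

-- With `tail-dart` and `head-dart` this identifies darts with ordered pairs of distinct lines.
dart-tail-head : ∀ {m} (d : PairDart m) {i j} .(p : i ≢ j) →
                 tail {m} d ≡ i → head {m} d ≡ j → dart i j p ≡ d
dart-tail-head {suc m} (s , false) p refl refl with Fin.splitAt m s in eq
... | inj₁ j = cong (_, false) (splitAt⁻¹-↑ˡ eq)
... | inj₂ t = trans (cong (Prod.map₁ (m Fin.↑ʳ_)) (dart-tail-head {m} (t , false) _ refl refl))
                     (cong (_, false) (splitAt⁻¹-↑ʳ eq))
dart-tail-head {suc m} (s , true) p refl refl with Fin.splitAt m s in eq
... | inj₁ j = cong (_, true) (splitAt⁻¹-↑ˡ eq)
... | inj₂ t = trans (cong (Prod.map₁ (m Fin.↑ʳ_)) (dart-tail-head {m} (t , true) _ refl refl))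
                     (cong (_, true) (splitAt⁻¹-↑ʳ eq))

Matrix : ℕ → Set
Matrix m = Fin m → Fin m → Bool

matrix : ∀ {m} → Chain (#pairs m) → Matrix m
matrix c zero zero = false
matrix {suc m} c zero (suc j) = c (j Fin.↑ˡ #pairs m)
matrix {suc m} c (suc i) zero = c (i Fin.↑ˡ #pairs m)
matrix {suc m} c (suc i) (suc j) = matrix (c ∘ (m Fin.↑ʳ_)) i j

matrix-sym : ∀ {m} (c : Chain (#pairs m)) i j → matrix {m} c i j ≡ matrix {m} c j i
matrix-sym c zero zero = refl
matrix-sym c zero (suc j) = refl
matrix-sym c (suc i) zero = refl
matrix-sym {suc m} c (suc i) (suc j) = matrix-sym (c ∘ (m Fin.↑ʳ_)) i j

matrix-diagonal : ∀ {m} (c : Chain (#pairs m)) i → matrix {m} c i i ≡ false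
matrix-diagonal c zero = refl
matrix-diagonal {suc m} c (suc i) = matrix-diagonal (c ∘ (m Fin.↑ʳ_)) i

matrix-lo-hi : ∀ {m} (c : Chain (#pairs m)) s → matrix {m} c (lo {m} s) (hi {m} s) ≡ c s
matrix-lo-hi {suc m} c s with Fin.splitAt m s in eq
... | inj₁ j = cong c (splitAt⁻¹-↑ˡ eq)
... | inj₂ t = trans (matrix-lo-hi {m} (c ∘ (m Fin.↑ʳ_)) t) (cong c (splitAt⁻¹-↑ʳ eq))

∑∑ : ∀ {m n} → (Fin m → Fin n → Bool) → Bool
∑∑ h = sum λ i → sum λ j → h i j

-- Peeling off the first row and column together follows the recursion of `#pairs` and puts
-- transposed entries side by side.
∑∑-pairs : ∀ {m} (h : Matrix m) → (∀ i → h i i ≡ false) →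
           ∑∑ h ≡ sum (λ s → h (lo {m} s) (hi {m} s) xor h (hi {m} s) (lo {m} s))
∑∑-pairs {zero} h h0 = refl
∑∑-pairs {suc m} h h0 = begin
  (h zero zero xor sum row) xor sum (λ i → column i xor sum (λ j → h (suc i) (suc j)))
    ≡⟨ cong₂ _xor_ (cong (_xor sum row) (h0 zero)) (∑-distrib-+ column _) ⟩
  sum row xor (sum column xor ∑∑ (λ i j → h (suc i) (suc j)))
    ≡⟨ Bool.xor-assoc (sum row) (sum column) _ ⟨
  (sum row xor sum column) xor ∑∑ (λ i j → h (suc i) (suc j))
    ≡⟨ cong₂ _xor_ (sym (∑-distrib-+ row column))
                   (∑∑-pairs (λ i j → h (suc i) (suc j)) (h0 ∘ suc)) ⟩
  sum (λ j → row j xor column j) xor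
  sum (λ s → h (suc (lo {m} s)) (suc (hi {m} s)) xor h (suc (hi {m} s)) (suc (lo {m} s)))
    ≡⟨ cong₂ _xor_ (sum-cong-≗ left) (sum-cong-≗ right) ⟨
  sum (g ∘ (Fin._↑ˡ #pairs m)) xor sum (g ∘ (m Fin.↑ʳ_))
    ≡⟨ sum-++ m g ⟨
  sum g ∎
  where
  open ≡-Reasoning
  row column : Fin m → Bool
  row j = h zero (suc j)
  column i = h (suc i) zero
  g : Fin (#pairs (suc m)) → Bool
  g s = h (lo {suc m} s) (hi {suc m} s) xor h (hi {suc m} s) (lo {suc m} s)
  left : ∀ j → g (j Fin.↑ˡ #pairs m) ≡ row j xor column j
  left j rewrite splitAt-↑ˡ m j (#pairs m) = refl
  right : ∀ s → g (m Fin.↑ʳ s) ≡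
                h (suc (lo {m} s)) (suc (hi {m} s)) xor h (suc (hi {m} s)) (suc (lo {m} s))
  right s rewrite splitAt-↑ʳ m (#pairs m) s = refl

-- Transposed entries cancel in characteristic 2.
∑∑-symmetric : ∀ {m} (h : Matrix m) → (∀ i → h i i ≡ false) →
               (∀ i j → h i j ≡ h j i) → ∑∑ h ≡ false
∑∑-symmetric {m} h h0 hs = trans (∑∑-pairs h h0) (sum-zero λ s →
  trans (cong (_xor h (hi {m} s) (lo {m} s)) (hs (lo {m} s) (hi {m} s)))
        (Bool.xor-same (h (hi {m} s) (lo {m} s))))

-- Corner sums of a matrix

upFrom : ∀ {m} → ℕ → Fin m → Bool
upFrom zero    i       = true
upFrom (suc a) zero    = false
upFrom (suc a) (suc i) = upFrom a i

upFrom-top : ∀ {m} (i : Fin m) → upFrom m i ≡ false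
upFrom-top zero    = refl
upFrom-top (suc i) = upFrom-top i

sum-upFrom : ∀ {m} (f : Fin m → Bool) i →
           sum (λ k → upFrom (toℕ i) k ∧ f k) ≡ f i xor sum (λ k → upFrom (suc (toℕ i)) k ∧ f k)
sum-upFrom f zero    = refl
sum-upFrom f (suc i) = sum-upFrom (f ∘ suc) i

sum-∧ : ∀ {m} b (f : Fin m → Bool) → sum (λ i → b ∧ f i) ≡ b ∧ sum f
sum-∧ true  f = refl
sum-∧ {m} false f = sum-zero {m} (λ _ → refl)

-- The thresholds are natural numbers so that the border value `m`, with an empty range, is
-- included.
corner : ∀ {m} → Matrix m → ℕ → ℕ → Bool
corner h a b = ∑∑ λ i j → upFrom a i ∧ (upFrom b j ∧ h i j)

corner-rows : ∀ {m} (h : Matrix m) a b →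
              corner h a b ≡ sum (λ i → upFrom a i ∧ sum (λ j → upFrom b j ∧ h i j))
corner-rows h a b = sum-cong-≗ λ i → sum-∧ (upFrom a i) (λ j → upFrom b j ∧ h i j)

-- Raising the first threshold past `i` drops row `i`; doing the same with columns leaves a single
-- entry.
corner-difference : ∀ {m} (h : Matrix m) i j →
  (corner h (toℕ i) (toℕ j) xor corner h (suc (toℕ i)) (toℕ j)) xor
  (corner h (toℕ i) (suc (toℕ j)) xor corner h (suc (toℕ i)) (suc (toℕ j))) ≡ h i j
corner-difference h i j = trans (cong₂ _xor_ (row (toℕ j)) (row (suc (toℕ j))))
  (trans (cong (_xor sum (λ k → upFrom (suc (toℕ j)) k ∧ h i k)) (sum-upFrom (h i) j))
         (xor-cancelʳ (h i j) _))
  where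
  row : ∀ b → corner h (toℕ i) b xor corner h (suc (toℕ i)) b ≡ sum (λ k → upFrom b k ∧ h i k)
  row b = trans
    (cong₂ _xor_ (trans (corner-rows h (toℕ i) b) (sum-upFrom _ i))
                 (corner-rows h (suc (toℕ i)) b))
    (xor-cancelʳ _ (sum (λ k → upFrom (suc (toℕ i)) k ∧ sum (λ j → upFrom b j ∧ h k j))))

corner-top : ∀ {m} (h : Matrix m) a → corner h a m ≡ false
corner-top {m} h a = trans (corner-rows h a m) (sum-zero λ i →
  trans (cong (upFrom a i ∧_) (sum-zero λ j → cong (_∧ h i j) (upFrom-top j))) (Bool.∧-zeroʳ _))

corner-bottom : ∀ {m} (h : Matrix m) → (∀ i → sum (h i) ≡ false) → ∀ a → corner h a 0 ≡ false
corner-bottom h h0 a = trans (corner-rows h a 0) (sum-zero λ i →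
  trans (cong (upFrom a i ∧_) (h0 i)) (Bool.∧-zeroʳ _))

module _ {m} (h : Matrix m) (h-sym : ∀ i j → h i j ≡ h j i) where

  corner-sym : ∀ a b → corner h a b ≡ corner h b a
  corner-sym a b = trans (∑-comm λ i j → upFrom a i ∧ (upFrom b j ∧ h i j))
    (sum-cong-≗ λ j → sum-cong-≗ λ i → trans
      (∧-exchange (upFrom a i) (upFrom b j) (h i j))
      (cong (λ x → upFrom b j ∧ (upFrom a i ∧ x)) (h-sym i j)))

  -- With equal thresholds the sum runs over a principal submatrix, again symmetric with zero
  -- diagonal.
  corner-diagonal : (∀ i → h i i ≡ false) → ∀ a → corner h a a ≡ false
  corner-diagonal h0 a = ∑∑-symmetric _
    (λ i → trans (cong (λ x → upFrom a i ∧ (upFrom a i ∧ x)) (h0 i))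
      (trans (cong (upFrom a i ∧_) (Bool.∧-zeroʳ (upFrom a i))) (Bool.∧-zeroʳ _)))
    (λ i j → trans (∧-exchange (upFrom a i) (upFrom a j) (h i j))
                   (cong (λ x → upFrom a j ∧ (upFrom a i ∧ x)) (h-sym i j)))

-- The cyclic successor

csuc cpred : ∀ {n} → Fin (suc n) → Fin (suc n)
csuc i with view i
... | ‵fromℕ     = zero
... | ‵inject₁ j = suc j
cpred zero    = Fin.fromℕ _
cpred (suc i) = Fin.inject₁ i

csuc-fromℕ : ∀ n → csuc (Fin.fromℕ n) ≡ zero
csuc-fromℕ n rewrite view-fromℕ n = refl

csuc-inject₁ : ∀ {n} (i : Fin n) → csuc (Fin.inject₁ i) ≡ suc i
csuc-inject₁ i rewrite view-inject₁ i = refl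

csuc-cpred : ∀ {n} (i : Fin (suc n)) → csuc (cpred i) ≡ i
csuc-cpred {n} zero = csuc-fromℕ n
csuc-cpred (suc i) = csuc-inject₁ i

cpred-csuc : ∀ {n} (i : Fin (suc n)) → cpred (csuc i) ≡ i
cpred-csuc i with view i
... | ‵fromℕ     = refl
... | ‵inject₁ j = refl

csuc≢ : ∀ {n} (i : Fin (suc (suc n))) → csuc i ≢ i
csuc≢ i p with view i
csuc≢ _ () | ‵fromℕ
csuc≢ _ p | ‵inject₁ j = 1+n≢n (trans (cong toℕ p) (toℕ-inject₁ j))

-- The map of the tangents to a conic

odd : ℕ → Bool
odd zero    = false
odd (suc n) = not (odd n)

bump : Bool → ℕ → ℕ
bump false n = n
bump true  n = suc n

odd-bump : ∀ ε n → odd (bump ε n) ≡ ε xor odd n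
odd-bump false n = refl
odd-bump true  n = refl

module CompleteMap (k : ℕ) where

  m : ℕ
  m = suc (suc k)

  -- Where lines i and j cross, the even region at end ε of line i is (i + t , j + ε) with t = ε + i
  -- + j modulo 2. It is also bordered by end t of line j, and f is to join these two ends.
  twist : Fin (#pairs m) → Bool
  twist s = odd (toℕ (lo {m} s)) xor odd (toℕ (hi {m} s))

  -- The cyclic order of the lines crossing line i.
  skip skip⁻¹ : Fin m → Fin m → Fin m
  skip i j with csuc j Fin.≟ i
  ... | yes _ = csuc (csuc j)
  ... | no  _ = csuc j
  skip⁻¹ i j with cpred j Fin.≟ i
  ... | yes _ = cpred (cpred j)
  ... | no  _ = cpred j

  skip≢ : ∀ i j → i ≢ skip i j
  skip≢ i j p with csuc j Fin.≟ i
  ... | yes refl = csuc≢ (csuc j) (sym p)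
  ... | no  q    = q (sym p)

  cpred≢ : ∀ (i : Fin m) → cpred i ≢ i
  cpred≢ i p = csuc≢ i (trans (cong csuc (sym p)) (csuc-cpred i))

  skip⁻¹≢ : ∀ i j → i ≢ skip⁻¹ i j
  skip⁻¹≢ i j p with cpred j Fin.≟ i
  ... | yes refl = cpred≢ (cpred j) (sym p)
  ... | no  q    = q (sym p)

  skip-skip⁻¹ : ∀ {i j} → i ≢ j → skip i (skip⁻¹ i j) ≡ j
  skip-skip⁻¹ {i} {j} i≢j with cpred j Fin.≟ i
  skip-skip⁻¹ {i} {j} i≢j | yes p with csuc (cpred (cpred j)) Fin.≟ i
  ... | yes _ = trans (cong csuc (csuc-cpred (cpred j))) (csuc-cpred j)
  ... | no  q = contradiction (trans (csuc-cpred (cpred j)) p) q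
  skip-skip⁻¹ {i} {j} i≢j | no  p with csuc (cpred j) Fin.≟ i
  ... | yes q = contradiction (trans (sym q) (csuc-cpred j)) i≢j
  ... | no  _ = csuc-cpred j

  skip⁻¹-skip : ∀ {i j} → i ≢ j → skip⁻¹ i (skip i j) ≡ j
  skip⁻¹-skip {i} {j} i≢j with csuc j Fin.≟ i
  skip⁻¹-skip {i} {j} i≢j | yes p with cpred (csuc (csuc j)) Fin.≟ i
  ... | yes _ = trans (cong cpred (cpred-csuc (csuc j))) (cpred-csuc j)
  ... | no  q = contradiction (trans (cpred-csuc (csuc j)) p) q
  skip⁻¹-skip {i} {j} i≢j | no  p with cpred (csuc j) Fin.≟ i
  ... | yes q = contradiction (trans (sym q) (cpred-csuc j)) i≢j
  ... | no  _ = cpred-csuc j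

  next prev : PairDart m → PairDart m
  next d = dart {m} (tail {m} d) (skip (tail {m} d) (head {m} d))
    (skip≢ (tail {m} d) (head {m} d))
  prev d = dart {m} (tail {m} d) (skip⁻¹ (tail {m} d) (head {m} d))
    (skip⁻¹≢ (tail {m} d) (head {m} d))

  next-dart : ∀ i j .(p : i ≢ j) → next (dart {m} i j p) ≡ dart i (skip i j) (skip≢ i j)
  next-dart i j p = dart-cong (tail-dart i j p) (cong₂ skip (tail-dart i j p) (head-dart i j p))

  next-prev : ∀ d → next (prev d) ≡ d
  next-prev d = trans (next-dart _ _ (skip⁻¹≢ (tail {m} d) (head {m} d)))
    (dart-tail-head {m} d _ refl (sym (skip-skip⁻¹ (tail≢head {m} d))))

  prev-next : ∀ d → prev (next d) ≡ d
  prev-next d = trans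
    (dart-cong {p′ = skip⁻¹≢ i (skip i (head {m} d))} (tail-dart i j p)
               (cong₂ skip⁻¹ (tail-dart i j p) (head-dart i j p)))
    (dart-tail-head {m} d _ refl (sym (skip⁻¹-skip (tail≢head {m} d))))
    where
    i = tail {m} d
    j = skip i (head {m} d)
    p = skip≢ i (head {m} d)

  open DartMap (#pairs m) twist next prev next-prev prev-next public
  open G M using (_~_; Cycles; Joins)
  private module ~ = Setoid Cycles

  -- The graph of the map is complete

  line : Flag → Fin m
  line (d , _) = tail {m} d

  line-α : ∀ x → line (α x) ≡ line x
  line-α (d , true)  = tail-dart {m} (tail {m} d) _ _
  line-α (d , false) = tail-dart {m} (tail {m} d) _ _

  base : Fin m → Flag
  base i = dart {m} i (csuc i) (≢-sym (csuc≢ i)) , false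

  -- Line `i` has no crossing in place `i`. That place is given the crossing with `csuc i`, the next
  -- one met, so that consecutive places are equivalent all the way round.
  rep : Fin m → Fin m → Flag
  rep i j with i Fin.≟ j
  ... | yes _ = base i
  ... | no  p = dart {m} i j p , false

  rep-≡ : ∀ i → rep i i ≡ base i
  rep-≡ i with i Fin.≟ i
  ... | yes _ = refl
  ... | no  p = contradiction refl p

  rep-≢ : ∀ {i j} (p : i ≢ j) → rep i j ≡ (dart {m} i j p , false)
  rep-≢ {i} {j} p with i Fin.≟ j
  ... | yes q = contradiction q p
  ... | no  _ = refl

  ~next : ∀ d → (d , false) ~ (next d , false)
  ~next d = ~.trans (~ν presentation (d , false)) (~α presentation (d , true))

  rep-csuc : ∀ i j → rep i j ~ rep i (csuc j)
  rep-csuc i j with i Fin.≟ j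
  ... | yes refl = ~.reflexive (sym (rep-≢ (≢-sym (csuc≢ i))))
  ... | no  p    = ~.trans (~next (dart {m} i j p))
                     (~.reflexive (trans (cong (_, false) (next-dart i j p)) rep-skip))
    where
    rep-skip : (dart {m} i (skip i j) (skip≢ i j) , false) ≡ rep i (csuc j)
    rep-skip with csuc j Fin.≟ i
    ... | yes refl = sym (rep-≡ i)
    ... | no  q    = sym (rep-≢ (≢-sym q))

  rep-zero : ∀ i j → rep i zero ~ rep i j
  rep-zero i = <-weakInduction (λ j → rep i zero ~ rep i j) ~.refl λ j p →
    ~.trans p (subst (λ j′ → rep i (Fin.inject₁ j) ~ rep i j′) (csuc-inject₁ j)
                     (rep-csuc i (Fin.inject₁ j)))

  -- By `rep-zero` all crossings on a line lie on one cycle of v and a. With `line-~`, these cycles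
  -- are exactly the lines.
  base~ : ∀ {i} x → line x ≡ i → base i ~ x
  base~ {i} (d , ε) refl = ~.trans (~.reflexive (sym (rep-≡ i)))
    (~.trans (~.sym (rep-zero i i)) (~.trans (rep-zero i (head {m} d))
    (~.trans (~.reflexive (trans (rep-≢ (tail≢head {m} d))
                                 (cong (_, false) (dart-tail-head {m} d _ refl refl))))
      (to-end ε))))
    where
    to-end : ∀ ε → (d , false) ~ (d , ε)
    to-end false = ~.refl
    to-end true  = ~ν presentation (d , false)

  line-base : ∀ i → line (base i) ≡ i
  line-base i = tail-dart {m} i (csuc i) _

  line-~ : ∀ {x y} → x ~ y → line x ≡ line y
  line-~ = ~-invariant presentation line (λ _ → refl) line-α

  lo-hi-dart : ∀ {i j : Fin m} (p : i Fin.< j) (d : PairDart m) →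
               tail {m} d ≡ i → head {m} d ≡ j → lo {m} (proj₁ d) ≡ i × hi {m} (proj₁ d) ≡ j
  lo-hi-dart p (s , false) q r = q , r
  lo-hi-dart p (s , true) refl refl = contradiction (lo<hi {m} s) (<-asym p)

  K≅M : K m ≅G M
  K≅M = record
    { vertices = record
      { to = base ; from = line
      ; to-cong = λ { refl → ~.refl } ; from-cong = line-~
      ; inverse = (λ { {x} refl → base~ x refl })
                , (λ {i} p → trans (line-~ p) (line-base i)) }
    ; edges = mk↔ₛ′ to from to-from from-to
    -- The chosen flag is on the line `lo`, and `φ` takes it to a flag on the line `hi`.
    ; ends = λ e → joins presentation ((to e , false) , false) refl
        (base~ _ (proj₁ (lo-hi e))) (base~ _ (proj₂ (lo-hi e)))
    }
    where
    H : Set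
    H = Graph.E (K m)

    to : H → Fin (#pairs m)
    to ((i , j) , [ p ]) = proj₁ (dart {m} i j (λ q → <-irrefl q p))

    from : Fin (#pairs m) → H
    from s = (lo {m} s , hi {m} s) , [ lo<hi {m} s ]

    to-from : ∀ s → to (from s) ≡ s
    to-from s = cong proj₁ (dart-tail-head {m} (s , false) _ refl refl)

    lo-hi : ∀ e → lo {m} (to e) ≡ proj₁ (value e) × hi {m} (to e) ≡ proj₂ (value e)
    lo-hi ((i , j) , [ p ]) = lo-hi-dart (recompute (i Fin.<? j) p)
      (dart {m} i j _) (tail-dart {m} i j _) (head-dart {m} i j _)

    from-to : ∀ e → from (to e) ≡ e
    from-to e@((i , j) , [ p ]) with p′ , q′ ← lo-hi e = ext p′ q′
      where
      ext : ∀ {i j i′ j′} .{p : i Fin.< j} .{p′ : i′ Fin.< j′} → i ≡ i′ → j ≡ j′ →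
            _≡_ {A = H} ((i , j) , [ p ]) ((i′ , j′) , [ p′ ])
      ext refl refl = refl

  -- Cycles are sums of coboundaries of the dual and the phial

  star-sum : ∀ {c} → (Coboundary M ⊥) c → ∀ i → sum (matrix {m} c i) ≡ false
  star-sum {c} c⊥ i = begin
    sum (matrix {m} c i)  ≡⟨ ∑∑-h ⟨
    ∑∑ h                  ≡⟨ ∑∑-pairs {m} h h-diagonal ⟩
    sum (λ s → h (lo {m} s) (hi {m} s) xor h (hi {m} s) (lo {m} s))
      ≡⟨ sum-cong-≗ on-square ⟩
    sum (λ s → c s ∧ (δ (lo {m} s) xor δ (hi {m} s)))
      ≡⟨ c⊥ _ star ⟩
    false ∎
    where
    open ≡-Reasoning
    δ : Fin m → Bool
    δ j = does (i Fin.≟ j)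

    h : Matrix m
    h j l = δ j ∧ matrix {m} c j l

    h-diagonal : ∀ j → h j j ≡ false
    h-diagonal j = trans (cong (δ j ∧_) (matrix-diagonal {m} c j)) (Bool.∧-zeroʳ (δ j))

    sum-δ : ∀ {n} (i : Fin n) (g : Fin n → Bool) → sum (λ j → does (i Fin.≟ j) ∧ g j) ≡ g i
    sum-δ {suc n} zero g =
      trans (cong (g zero xor_) (sum-zero {n} λ j → refl)) (Bool.xor-identityʳ _)
    sum-δ (suc i) g = sum-δ i (g ∘ suc)

    ∑∑-h : ∑∑ h ≡ sum (matrix {m} c i)
    ∑∑-h = trans (sum-cong-≗ λ j → sum-∧ (δ j) (matrix {m} c j))
                 (sum-δ i (λ j → sum (matrix {m} c j)))

    on-square : ∀ s → h (lo {m} s) (hi {m} s) xor h (hi {m} s) (lo {m} s) ≡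
                      c s ∧ (δ (lo {m} s) xor δ (hi {m} s))
    on-square s = begin
      h (lo {m} s) (hi {m} s) xor h (hi {m} s) (lo {m} s)
        ≡⟨ cong₂ (λ x y → (δ (lo {m} s) ∧ x) xor (δ (hi {m} s) ∧ y)) (matrix-lo-hi {m} c s)
             (trans (matrix-sym {m} c (hi {m} s) (lo {m} s)) (matrix-lo-hi {m} c s)) ⟩
      (δ (lo {m} s) ∧ c s) xor (δ (hi {m} s) ∧ c s)
        ≡⟨ Bool.∧-distribʳ-xor (c s) (δ (lo {m} s)) (δ (hi {m} s)) ⟨
      (δ (lo {m} s) xor δ (hi {m} s)) ∧ c s
        ≡⟨ Bool.∧-comm _ (c s) ⟩
      c s ∧ (δ (lo {m} s) xor δ (hi {m} s)) ∎

    -- Orthogonality to the star of line `i`, the coboundary of its indicator, is what makes row `i`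
    -- sum to zero.
    star : Coboundary M (λ s → δ (lo {m} s) xor δ (hi {m} s))
    star = coboundary presentation (δ ∘ line) (λ _ → refl) (λ x → cong δ (line-α x))
      λ { ((s , false) , ε) → refl ; ((s , true) , ε) → Bool.xor-comm (δ (lo {m} s)) _ }

  -- μ false and μ true are the involutions along f and z, whose cycles with
  -- the a-edges bound the regions of the two colours.
  μ : Bool → Flag → Flag
  μ β ((s , b) , ε) = (s , not b) , (β xor (ε xor twist s))

  module _ (c : Chain (#pairs m)) (c⊥ : (Coboundary M ⊥) c) where

    h : Matrix m
    h = matrix {m} c

    S : ℕ → ℕ → Bool
    S = corner h

    S-sym : ∀ a b → S a b ≡ S b a
    S-sym = corner-sym h (matrix-sym {m} c)

    S-diagonal : ∀ a → S a a ≡ false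
    S-diagonal = corner-diagonal h (matrix-sym {m} c) (matrix-diagonal {m} c)

    -- The half-segment of line i between its crossings with the lines b - 1
    -- and b borders the regions (i , b) and (i + 1 , b); γ β i b is the value
    -- of S on the one of colour β.
    γ : Bool → ℕ → ℕ → Bool
    γ β i b = S (bump (β xor (odd i xor odd b)) i) b

    γ-csuc : ∀ β i (j : Fin m) → γ β i (toℕ (csuc j)) ≡ γ β i (suc (toℕ j))
    γ-csuc β i j with view j
    ... | ‵fromℕ = trans (corner-bottom h (star-sum c⊥) (bump (β xor (odd i xor odd 0)) i))
                     (sym (trans (cong (γ β i ∘ suc) (toℕ-fromℕ (suc k)))
                                 (corner-top h (bump (β xor (odd i xor odd m)) i))))
    ... | ‵inject₁ j = cong (γ β i ∘ suc) (sym (toℕ-inject₁ j))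

    -- This carries the value over the point of tangency, where `skip` leaves out line `i` itself.
    -- For `false` both sides are diagonal values of `S`, hence zero; for `true` they are mirror
    -- images.
    γ-diagonal : ∀ β i → γ β i i ≡ γ β i (suc i)
    γ-diagonal β i
      rewrite sym (Bool.not-distribʳ-xor (odd i) (odd i)) | Bool.xor-same (odd i)
      with β
    ... | false = trans (S-diagonal i) (sym (S-diagonal (suc i)))
    ... | true  = S-sym (suc i) i

    γ-skip : ∀ β i j → γ β (toℕ i) (toℕ (skip i j)) ≡ γ β (toℕ i) (suc (toℕ j))
    γ-skip β i j with csuc j Fin.≟ i
    ... | yes refl = trans (γ-csuc β (toℕ i) (csuc j))
                       (trans (sym (γ-diagonal β (toℕ i))) (γ-csuc β (toℕ i) j))
    ... | no  _    = γ-csuc β (toℕ i) j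

    -- End `false` of a dart lies just before the crossing with line `head` and end `true` just
    -- after it, whence the `bump`.
    w : Bool → Flag → Bool
    w β (d , ε) = γ β (toℕ (tail {m} d)) (bump ε (toℕ (head {m} d)))

    w-α : ∀ β x → w β (α x) ≡ w β x
    w-α β (d , true) = trans
      (cong₂ (λ i j → γ β (toℕ i) (toℕ j)) (tail-dart {m} i j p) (head-dart {m} i j p))
      (γ-skip β i (head {m} d))
      where
      i = tail {m} d
      j = skip i (head {m} d)
      p = skip≢ i (head {m} d)
    w-α β (d , false) =
      trans (sym (w-α β (prev d , true))) (cong (λ d → w β (d , false)) (next-prev d))

    -- Both sides are the value of `S` on the one region of colour β that the two half-segments
    -- share: `S` is symmetric, and parity determines one bump from the other.
    γ-swap : ∀ β ε i j → γ β j (bump (β xor (ε xor (odd i xor odd j))) i) ≡ γ β i (bump ε j)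
    γ-swap β ε i j = begin
      S (bump (β xor (odd j xor odd (bump ε′ i))) j) (bump ε′ i)
        ≡⟨ S-sym (bump (β xor (odd j xor odd (bump ε′ i))) j) (bump ε′ i) ⟩
      S (bump ε′ i) (bump (β xor (odd j xor odd (bump ε′ i))) j)
        ≡⟨ cong₂ (λ x y → S (bump x i) (bump y j)) ε′≡
             (trans (cong (λ x → β xor (odd j xor x)) (odd-bump ε′ i)) ≡ε) ⟩
      S (bump (β xor (odd i xor odd (bump ε j))) i) (bump ε j) ∎
      where
      open ≡-Reasoning
      ε′ : Bool
      ε′ = β xor (ε xor (odd i xor odd j))
      ε′≡ : ε′ ≡ β xor (odd i xor odd (bump ε j))
      ε′≡ = trans
        (xor-move β ε (odd i) (odd j))
        (cong (λ x → β xor (odd i xor x)) (sym (odd-bump ε j)))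
      ≡ε : β xor (odd j xor (ε′ xor odd i)) ≡ ε
      ≡ε = xor-collapse β ε (odd i) (odd j)

    w-μ : ∀ β x → w β (μ β x) ≡ w β x
    w-μ β ((s , false) , ε) = γ-swap β ε (toℕ (lo {m} s)) (toℕ (hi {m} s))
    w-μ β ((s , true) , ε) =
      trans (cong (λ t → γ β i (bump (β xor (ε xor t)) j)) (Bool.xor-comm (odd i) (odd j)))
            (γ-swap β ε j i)
      where
      i = toℕ (lo {m} s)
      j = toℕ (hi {m} s)

    δw : Bool → Chain (#pairs m)
    δw β s = w β ((s , false) , false) xor w β ((s , false) , true)

    δw-false : ∀ β s ε → δw β s ≡ w β ((s , false) , ε) xor w β ((s , false) , not ε)
    δw-false β s false = refl
    δw-false β s true  = Bool.xor-comm (w β ((s , false) , false)) _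

    -- `δw` reads off the v-edge `false`; the invariance `w-μ` transports the difference to the
    -- v-edge `true`.
    δw-flag : ∀ β x → δw β (square-of x) ≡ w β x xor w β (ν x)
    δw-flag β ((s , false) , ε) = δw-false β s ε
    δw-flag β x@((s , true) , ε) = trans (δw-false β s (β xor (ε xor twist s)))
      (cong₂ _xor_ (w-μ β x) (trans (cong (λ ε → w β ((s , false) , ε)) not-μ) (w-μ β (ν x))))
      where
      not-μ : not (β xor (ε xor twist s)) ≡ β xor (not ε xor twist s)
      not-μ = trans (Bool.not-distribʳ-xor β (ε xor twist s))
                    (cong (β xor_) (Bool.not-distribˡ-xor ε (twist s)))

    c≡δw : ∀ s → c s ≡ δw false s xor δw true s
    c≡δw s = begin
      c s  ≡⟨ matrix-lo-hi {m} c s ⟨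
      h (lo {m} s) (hi {m} s)  ≡⟨ corner-difference h (lo {m} s) (hi {m} s) ⟨
      (S i j xor S (suc i) j) xor (S i (suc j) xor S (suc i) (suc j))
        -- Opposite regions at the crossing have the same colour, so the four corner values regroup
        -- into two diagonal pairs; the parity of i + j tells which pair has colour `false`.
        ≡⟨ by-parity (odd i xor odd j) ⟩
      regions (odd i xor odd j) (not (odd i xor odd j))
        ≡⟨ cong (regions (odd i xor odd j)) (Bool.not-distribʳ-xor (odd i) (odd j)) ⟩
      δw false s xor δw true s ∎
      where
      open ≡-Reasoning
      i = toℕ (lo {m} s)
      j = toℕ (hi {m} s)
      regions : Bool → Bool → Bool
      regions t t′ = (S (bump t i) j xor S (bump t′ i) (suc j)) xor
                     (S (bump (not t) i) j xor S (bump (not t′) i) (suc j))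
      by-parity : ∀ t → (S i j xor S (suc i) j) xor (S i (suc j) xor S (suc i) (suc j)) ≡
                        regions t (not t)
      by-parity false = xor-pair-diagonals
        (S i j) (S (suc i) j) (S i (suc j)) (S (suc i) (suc j))
      by-parity true = trans (by-parity false)
        (Bool.xor-comm (S i j xor S (suc i) (suc j)) (S (suc i) j xor S i (suc j)))

  rich : Rich M
  rich = (λ {c} c⊥ → δw c c⊥ false , δw c c⊥ true ,
           coboundary dual-presentation (w c c⊥ false)
             (w-μ c c⊥ false) (w-α c c⊥ false) (δw-flag c c⊥ false) ,
           coboundary phial-presentation (w c c⊥ true)
             (w-μ c c⊥ true) (w-α c c⊥ true) (δw-flag c c⊥ true) ,
           c≡δw c c⊥)
       , dual⊞phial⊆⊥

  K-mapRich : MapRich (K m)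
  K-mapRich = M , isMap , rich , K≅M

theorem2p11 : (n : ℕ) → 1 ≤ n → MapRich (K (2 * n))
-- `2 * suc n` computes to `suc (n + suc (n + 0))`; `+-suc` exposes the second successor that
-- `CompleteMap` expects.
theorem2p11 (suc n) _ = subst (MapRich ∘ K) (cong suc (sym (+-suc n (n ℕ.+ 0))))
  (CompleteMap.K-mapRich (n ℕ.+ (n ℕ.+ 0)))
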